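{- Let $D$ be a strongly connected digraph whose line digraph $LD$ has minimum in-degree $\delta^-\ge 2$. Then $LD$ does not admit a $(1,\le 3)$-identifying code.
   Context: Digraphs are finite, without loops or multiple arcs; digons (both arcs $(u,v)$ and $(v,u)$) are allowed. $N^-(u)$ and $N^+(u)$ are the in- and out-neighbourhoods, $N^-[u]=\{u\}\cup N^-(u)$, $N^+[u]=\{u\}\cup N^+(u)$, and $N^{\pm}[U]=\bigcup_{u\in U}N^{\pm}[u]$. The line digraph $LD$ of $D$ has vertex set the arc set of $D$, and a vertex $uv$ (for the arc $(u,v)$) is adjacent to $wz$ if and only if $v=w$. For an integer $\ell\ge1$, a $(1,\le\ell)$-identifying code in a digraph $G$ is a set $C\subseteq V(G)$ that is dominating ($N^+[C]=V(G)$) and such that $N^-[X]\cap C\ne N^-[Y]\cap C$ for all distinct $X,Y\subseteq V(G)$ with $1\le|X|,|Y|\le\ell$. $G$ admits a $(1,\le \ell)$-identifying code if one exists; equivalently, if $N^-[X]\neq N^-[Y]$ for all such distinct $X,Y$. -}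

module Defs where

open import Data.Fin.Base using (Fin)
open import Data.Fin.Properties using () renaming (_≟_ to _≟ᶠ_)
open import Data.Fin.Subset using (Subset; _∪_; _∩_; ⋃; ⁅_⁆; ⊤; ∣_∣)
open import Data.Fin.Subset.Properties using (_∈?_)
open import Data.List.Base using (List; allFin; cartesianProduct; filter; length; lookup; map)
open import Data.List.Membership.Propositional.Properties using (∈-filter⁻; ∈-lookup)
open import Data.Nat.Base using (ℕ; _≤_)
open import Data.Product.Base using (∃; _×_; _,_; proj₁; proj₂)
open import Data.Vec.Base using (tabulate)
open import Level using (0ℓ)
open import Relation.Binary.Construct.Closure.ReflexiveTransitive using (Star)
open import Relation.Binary.Core using (Rel)
open import Relation.Binary.Definitions using (Decidable; Irreflexive)
open import Relation.Binary.PropositionalEquality using (_≡_; _≢_; refl; sym)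
open import Relation.Nullary.Decidable using (does)
open import Relation.Unary using (Pred) renaming (Decidable to Decidable₁)

-- Digons are permitted. Inhabitants of Arc u v are never counted (only
-- whether one exists matters), so there are no multiple arcs.
record Digraph (n : ℕ) : Set₁ where
  field
    Arc      : Rel (Fin n) 0ℓ
    arc?     : Decidable Arc
    loopless : Irreflexive _≡_ Arc

  N⁻ N⁺ N⁻[_] N⁺[_] : Fin n → Subset n
  N⁻ u     = tabulate λ v → does (arc? v u)
  N⁺ u     = tabulate λ v → does (arc? u v)
  N⁻[ u ]  = ⁅ u ⁆ ∪ N⁻ u
  N⁺[ u ]  = ⁅ u ⁆ ∪ N⁺ u

  N⁻[[_]] N⁺[[_]] : Subset n → Subset n
  N⁻[[ U ]] = ⋃ (map N⁻[_] (filter (_∈? U) (allFin n)))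
  N⁺[[ U ]] = ⋃ (map N⁺[_] (filter (_∈? U) (allFin n)))

module _ {n : ℕ} (G : Digraph n) where
  open Digraph G

  StronglyConnected : Set
  StronglyConnected = ∀ u v → Star Arc u v

  -- A relation rather than a function, since the minimum in-degree is
  -- undefined for the digraph without vertices.
  IsMinInDegree : ℕ → Set
  IsMinInDegree δ = (∃ λ u → ∣ N⁻ u ∣ ≡ δ) × (∀ u → δ ≤ ∣ N⁻ u ∣)

  IsIdentifyingCode : ℕ → Subset n → Set
  IsIdentifyingCode ℓ C =
    N⁺[[ C ]] ≡ ⊤ ×
    (∀ X Y → X ≢ Y →
      1 ≤ ∣ X ∣ → ∣ X ∣ ≤ ℓ → 1 ≤ ∣ Y ∣ → ∣ Y ∣ ≤ ℓ →
      N⁻[[ X ]] ∩ C ≢ N⁻[[ Y ]] ∩ C)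

  AdmitsIdentifyingCode : ℕ → Set
  AdmitsIdentifyingCode ℓ = ∃ λ C → IsIdentifyingCode ℓ C

module _ {n : ℕ} (D : Digraph n) where
  open Digraph D

  IsArc : Pred (Fin n × Fin n) 0ℓ
  IsArc (u , v) = Arc u v

  isArc? : Decidable₁ IsArc
  isArc? (u , v) = arc? u v

  -- Every arc occurs exactly once, so positions in this list correspond
  -- bijectively to arcs.
  arcs : List (Fin n × Fin n)
  arcs = filter isArc? (cartesianProduct (allFin n) (allFin n))

  tail head : Fin (length arcs) → Fin n
  tail i = proj₁ (lookup arcs i)
  head i = proj₂ (lookup arcs i)

  tail→head : ∀ i → Arc (tail i) (head i)
  tail→head i = proj₂
    (∈-filter⁻ isArc? {xs = cartesianProduct (allFin n) (allFin n)} (∈-lookup {xs = arcs} i))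

  -- A vertex i stands for the i-th arc of D, from tail i to head i.
  LineDigraph : Digraph (length arcs)
  LineDigraph = record
    { Arc      = λ i j → head i ≡ tail j
    ; arc?     = λ i j → head i ≟ᶠ tail j
    ; loopless = λ { {i} refl h≡t → loopless (sym h≡t) (tail→head i) }
    }

{-# OPTIONS --safe #-}

-- Let c ≠ d be arcs with a common tail, and let a and b be arcs leaving
-- head c and head d. Then c and d have the same in-neighbours in LD, c ∈ N⁻(a)
-- and d ∈ N⁻(b), so {a, b, c} and {a, b, d} have the same closed
-- in-neighbourhood, although d ∉ {a, b, c}. Such c and d exist by the
-- pigeonhole principle: every vertex of D has in-degree at least 2, so D has
-- more arcs than vertices.
module Submission where

open import Defs
open import Data.Bool.Base using (true)
open import Data.Fin.Base using (Fin; zero; suc; _<_)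
open import Data.Fin.Properties using (pigeonhole; <⇒≢; suc-injective; _≟_)
open import Data.Fin.Subset
  using (Subset; _∪_; _∩_; ⋃; ⁅_⁆; ∣_∣; _∈_; _∉_; _⊆_; Nonempty; inside; outside)
open import Data.Fin.Subset.Properties
  using ( _∈?_; x∈p∪q⁺; x∈p∪q⁻; x∈⁅x⁆; x∈⁅y⁆⇒x≡y; ∉⊥; ⊆-antisym; p⊆q⇒∣p∣≤∣q∣
        ; ∣⁅x⁆∣≡1; ∣⊥∣≡0; nonempty?; Empty-unique )
open import Data.List.Base using (List; []; _∷_; allFin; length)
open import Data.List.Membership.Propositional using () renaming (_∈_ to _∈ˡ_)
open import Data.List.Membership.Propositional.Properties
  using (∈-filter⁺; ∈-allFin; ∈-cartesianProduct⁺; ∈-map∘filter⁺; ∈-map∘filter⁻)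
open import Data.List.Relation.Unary.Any using (here; there; index)
open import Data.List.Relation.Unary.Any.Properties using (lookup-index)
open import Data.Nat.Base using (ℕ; suc; _≤_; s≤s; _+_)
open import Data.Nat.Properties
  using (≤-refl; ≤-trans; ≤-reflexive; m≤n⇒m≤1+n; +-suc; +-mono-≤)
open import Data.Product.Base using (∃; ∃₂; _×_; _,_; proj₁; proj₂)
open import Data.Sum.Base using (_⊎_; inj₁; inj₂; [_,_]′)
open import Data.Vec.Base using ([]; _∷_; here; there; tabulate)
open import Data.Vec.Properties using (lookup∘tabulate; []=⇒lookup; lookup⇒[]=)
open import Function.Base using (_∘_)
open import Level using (0ℓ)
open import Relation.Binary.Construct.Closure.ReflexiveTransitive using (ε; _◅_)
open import Relation.Binary.PropositionalEquality
  using (_≡_; _≢_; refl; sym; trans; cong; cong₂; subst)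
open import Relation.Nullary.Decidable using (does; proof; yes; no; dec-true)
open import Relation.Nullary.Negation.Core using (¬_; contradiction)
open import Relation.Nullary.Reflects using (Reflects; invert)
open import Relation.Unary using (Pred) renaming (Decidable to Decidable₁)

∣p∪q∣≤∣p∣+∣q∣ : ∀ {n} (p q : Subset n) → ∣ p ∪ q ∣ ≤ ∣ p ∣ + ∣ q ∣
∣p∪q∣≤∣p∣+∣q∣ []            []            = ≤-refl
∣p∪q∣≤∣p∣+∣q∣ (outside ∷ p) (outside ∷ q) = ∣p∪q∣≤∣p∣+∣q∣ p q
∣p∪q∣≤∣p∣+∣q∣ (outside ∷ p) (inside  ∷ q)
  rewrite +-suc ∣ p ∣ ∣ q ∣ = s≤s (∣p∪q∣≤∣p∣+∣q∣ p q)
∣p∪q∣≤∣p∣+∣q∣ (inside  ∷ p) (outside ∷ q) = s≤s (∣p∪q∣≤∣p∣+∣q∣ p q)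
∣p∪q∣≤∣p∣+∣q∣ (inside  ∷ p) (inside  ∷ q)
  rewrite +-suc ∣ p ∣ ∣ q ∣ = s≤s (m≤n⇒m≤1+n (∣p∪q∣≤∣p∣+∣q∣ p q))

-- An inequality rather than a count, since the three points may coincide.
∣triple∣≤3 : ∀ {n} (x y z : Fin n) → ∣ (⁅ x ⁆ ∪ ⁅ y ⁆) ∪ ⁅ z ⁆ ∣ ≤ 3
∣triple∣≤3 x y z =
  ≤-trans (∣p∪q∣≤∣p∣+∣q∣ (⁅ x ⁆ ∪ ⁅ y ⁆) ⁅ z ⁆)
    (+-mono-≤
      (≤-trans (∣p∪q∣≤∣p∣+∣q∣ ⁅ x ⁆ ⁅ y ⁆)
        (≤-reflexive (cong₂ _+_ (∣⁅x⁆∣≡1 x) (∣⁅x⁆∣≡1 y))))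
      (≤-reflexive (∣⁅x⁆∣≡1 z)))

x∈p⇒1≤∣p∣ : ∀ {n} {x : Fin n} {p : Subset n} → x ∈ p → 1 ≤ ∣ p ∣
x∈p⇒1≤∣p∣ {x = x} {p} x∈p =
  subst (_≤ ∣ p ∣) (∣⁅x⁆∣≡1 x)
    (p⊆q⇒∣p∣≤∣q∣ λ y∈⁅x⁆ → subst (_∈ p) (sym (x∈⁅y⁆⇒x≡y x y∈⁅x⁆)) x∈p)

1≤∣p∣⇒Nonempty : ∀ {n} (p : Subset n) → 1 ≤ ∣ p ∣ → Nonempty p
1≤∣p∣⇒Nonempty {n} p 1≤∣p∣ with nonempty? p
... | yes x∈p   = x∈p
... | no  empty =
  contradiction (subst (1 ≤_) (trans (cong ∣_∣ (Empty-unique empty)) (∣⊥∣≡0 n)) 1≤∣p∣) λ ()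

2≤∣p∣⇒distinct : ∀ {n} (p : Subset n) → 2 ≤ ∣ p ∣ → ∃₂ λ x y → x ≢ y × x ∈ p × y ∈ p
2≤∣p∣⇒distinct (inside ∷ p) (s≤s 1≤∣p∣) =
  let y , y∈p = 1≤∣p∣⇒Nonempty p 1≤∣p∣
  in  zero , suc y , (λ ()) , here , there y∈p
2≤∣p∣⇒distinct (outside ∷ p) 2≤∣p∣ =
  let x , y , x≢y , x∈p , y∈p = 2≤∣p∣⇒distinct p 2≤∣p∣
  in  suc x , suc y , x≢y ∘ suc-injective , there x∈p , there y∈p

module _ {n} {P : Pred (Fin n) 0ℓ} (P? : Decidable₁ P) where

  ∈-tabulate-does⁺ : ∀ {x} → P x → x ∈ tabulate (λ y → does (P? y))
  ∈-tabulate-does⁺ {x} Px =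
    lookup⇒[]= x _ (trans (lookup∘tabulate _ x) (dec-true (P? x) Px))

  ∈-tabulate-does⁻ : ∀ {x} → x ∈ tabulate (λ y → does (P? y)) → P x
  ∈-tabulate-does⁻ {x} x∈ =
    invert (subst (Reflects (P x)) does≡true (proof (P? x)))
    where
    does≡true : does (P? x) ≡ true
    does≡true = trans (sym (lookup∘tabulate _ x)) ([]=⇒lookup x∈)

x∈⋃⁺ : ∀ {n} {x : Fin n} {p} {ps : List (Subset n)} → p ∈ˡ ps → x ∈ p → x ∈ ⋃ ps
x∈⋃⁺ (here refl)  x∈p = x∈p∪q⁺ (inj₁ x∈p)
x∈⋃⁺ (there p∈ps) x∈p = x∈p∪q⁺ (inj₂ (x∈⋃⁺ p∈ps x∈p))

x∈⋃⁻ : ∀ {n} {x : Fin n} (ps : List (Subset n)) → x ∈ ⋃ ps → ∃ λ p → p ∈ˡ ps × x ∈ p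
x∈⋃⁻ []       x∈⊥ = contradiction x∈⊥ ∉⊥
x∈⋃⁻ (p ∷ ps) x∈  with x∈p∪q⁻ p (⋃ ps) x∈
... | inj₁ x∈p   = p , here refl , x∈p
... | inj₂ x∈⋃ps = let q , q∈ps , x∈q = x∈⋃⁻ ps x∈⋃ps in q , there q∈ps , x∈q

module _ {n} (G : Digraph n) where
  open Digraph G

  -- Together with its converse, this trades the union over a filtered list for a pointwise
  -- description, the form in which later arguments handle closed in-neighbourhoods.
  x∈N⁻[[U]]⁺ : ∀ {x u U} → u ∈ U → x ≡ u ⊎ Arc x u → x ∈ N⁻[[ U ]]
  x∈N⁻[[U]]⁺ {x} {u} {U} u∈U x≤u =
    x∈⋃⁺ (∈-map∘filter⁺ N⁻[_] (_∈? U) (u , ∈-allFin u , refl , u∈U))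
      (x∈p∪q⁺ ([ (λ { refl → inj₁ (x∈⁅x⁆ u) }) , inj₂ ∘ ∈-tabulate-does⁺ (λ v → arc? v u) ]′ x≤u))

  x∈N⁻[[U]]⁻ : ∀ {x} U → x ∈ N⁻[[ U ]] → ∃ λ u → u ∈ U × (x ≡ u ⊎ Arc x u)
  x∈N⁻[[U]]⁻ U x∈ with x∈⋃⁻ _ x∈
  ... | _ , p∈ , x∈p with ∈-map∘filter⁻ N⁻[_] (_∈? U) {xs = allFin n} p∈
  ...   | u , _ , refl , u∈U with x∈p∪q⁻ ⁅ u ⁆ (N⁻ u) x∈p
  ...     | inj₁ x∈⁅u⁆ = u , u∈U , inj₁ (x∈⁅y⁆⇒x≡y u x∈⁅u⁆)
  ...     | inj₂ x∈N⁻u = u , u∈U , inj₂ (∈-tabulate-does⁻ (λ v → arc? v u) x∈N⁻u)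

  -- Exchanging `c` for `d` puts at risk only `c` itself and its in-neighbours. The former is
  -- recovered as an in-neighbour of `a`, which stays in the set; the latter are in-neighbours of
  -- `d`.
  N⁻[[∪⁅⁆]]-⊆ : ∀ {U a c d} → a ∈ U → Arc c a → (∀ {x} → Arc x c → Arc x d) →
                N⁻[[ U ∪ ⁅ c ⁆ ]] ⊆ N⁻[[ U ∪ ⁅ d ⁆ ]]
  N⁻[[∪⁅⁆]]-⊆ {U} {a} {c} {d} a∈U c→a N⁻c⊆N⁻d x∈ with x∈N⁻[[U]]⁻ (U ∪ ⁅ c ⁆) x∈
  ... | u , u∈U∪c , x≤u with x∈p∪q⁻ U ⁅ c ⁆ u∈U∪c
  ...   | inj₁ u∈U = x∈N⁻[[U]]⁺ (x∈p∪q⁺ (inj₁ u∈U)) x≤u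
  ...   | inj₂ u∈⁅c⁆ with x∈⁅y⁆⇒x≡y c u∈⁅c⁆ | x≤u
  ...     | refl | inj₁ refl = x∈N⁻[[U]]⁺ (x∈p∪q⁺ (inj₁ a∈U)) (inj₂ c→a)
  ...     | refl | inj₂ x→c  = x∈N⁻[[U]]⁺ (x∈p∪q⁺ (inj₂ (x∈⁅x⁆ d))) (inj₂ (N⁻c⊆N⁻d x→c))

  twins⇒¬AdmitsIdentifyingCode-3 : ∀ {a b c d} →
    (∀ {x} → Arc x c → Arc x d) → (∀ {x} → Arc x d → Arc x c) →
    Arc c a → Arc d b → d ≢ a → d ≢ b → d ≢ c →
    ¬ AdmitsIdentifyingCode G 3
  twins⇒¬AdmitsIdentifyingCode-3 {a} {b} {c} {d} N⁻c⊆N⁻d N⁻d⊆N⁻c c→a d→b d≢a d≢b d≢c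
    (C , _ , separates) =
    separates (U ∪ ⁅ c ⁆) (U ∪ ⁅ d ⁆) (λ X≡Y → d∉X (subst (d ∈_) (sym X≡Y) d∈Y))
      (x∈p⇒1≤∣p∣ (x∈p∪q⁺ {p = U} (inj₂ (x∈⁅x⁆ c)))) (∣triple∣≤3 a b c)
      (x∈p⇒1≤∣p∣ d∈Y) (∣triple∣≤3 a b d)
      -- The closed in-neighbourhoods agree before intersecting with `C`, so no choice of `C` can
      -- separate the two sets. The inclusions are the same exchange in both directions, with `a`
      -- recovering `c` and `b` recovering `d`.
      (cong (_∩ C) (⊆-antisym
        (N⁻[[∪⁅⁆]]-⊆ (x∈p∪q⁺ (inj₁ (x∈⁅x⁆ a))) c→a N⁻c⊆N⁻d)
        (N⁻[[∪⁅⁆]]-⊆ (x∈p∪q⁺ (inj₂ (x∈⁅x⁆ b))) d→b N⁻d⊆N⁻c)))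
    where
    U : Subset n
    U = ⁅ a ⁆ ∪ ⁅ b ⁆

    d∈Y : d ∈ U ∪ ⁅ d ⁆
    d∈Y = x∈p∪q⁺ (inj₂ (x∈⁅x⁆ d))

    d∉X : d ∉ U ∪ ⁅ c ⁆
    d∉X d∈X with x∈p∪q⁻ U ⁅ c ⁆ d∈X
    ... | inj₂ d∈⁅c⁆ = d≢c (x∈⁅y⁆⇒x≡y c d∈⁅c⁆)
    ... | inj₁ d∈U with x∈p∪q⁻ ⁅ a ⁆ ⁅ b ⁆ d∈U
    ...   | inj₁ d∈⁅a⁆ = d≢a (x∈⁅y⁆⇒x≡y a d∈⁅a⁆)
    ...   | inj₂ d∈⁅b⁆ = d≢b (x∈⁅y⁆⇒x≡y b d∈⁅b⁆)

module _ {n} (D : Digraph n) where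
  open Digraph D

  private
    Vertexᴸ : Set
    Vertexᴸ = Fin (length (arcs D))

  Arc⇒index : ∀ {u v} → Arc u v → ∃ λ i → tail D i ≡ u
  Arc⇒index {u} {v} u→v = index uv∈arcs , cong proj₁ (sym (lookup-index uv∈arcs))
    where
    uv∈arcs : (u , v) ∈ˡ arcs D
    uv∈arcs = ∈-filter⁺ (isArc? D) (∈-cartesianProduct⁺ (∈-allFin u) (∈-allFin v)) u→v

  tail≢head : ∀ i → tail D i ≢ head D i
  tail≢head i t≡h = loopless t≡h (tail→head D i)

  -- Follow a walk from `v` to the tail of `i₀`: if it is empty, `i₀` itself leaves `v`; otherwise
  -- its first step is an arc leaving `v`.
  outArc : StronglyConnected D → Vertexᴸ → ∀ v → ∃ λ i → tail D i ≡ v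
  outArc connected i₀ v with connected v (tail D i₀)
  ... | ε       = i₀ , refl
  ... | v→w ◅ _ = Arc⇒index v→w

  -- The in-neighbours in the line digraph of an arc leaving `v` are exactly the arcs entering `v`.
  -- As every vertex has an outgoing arc, the degree bound on arcs passes to all vertices of `D`.
  inArcs : (∀ v → ∃ λ i → tail D i ≡ v) → (∀ i → 2 ≤ ∣ Digraph.N⁻ (LineDigraph D) i ∣) →
           ∀ v → ∃₂ λ i j → i ≢ j × head D i ≡ v × head D j ≡ v
  inArcs out 2≤∣N⁻∣ v with out v
  ... | o , refl =
    let i , j , i≢j , i∈ , j∈ = 2≤∣p∣⇒distinct _ (2≤∣N⁻∣ o)
    in  i , j , i≢j , ∈-tabulate-does⁻ into-v? i∈ , ∈-tabulate-does⁻ into-v? j∈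
    where
    into-v? : Decidable₁ (λ i → head D i ≡ tail D o)
    into-v? i = head D i ≟ tail D o

  -- One chosen arc `p v` into each vertex `v`, plus a second arc `q₀` into `v₀`, makes `n + 1`
  -- distinct arcs with only `n` possible tails.
  commonTail : Fin n → (∀ v → ∃₂ λ i j → i ≢ j × head D i ≡ v × head D j ≡ v) →
               ∃₂ λ c d → c ≢ d × tail D c ≡ tail D d
  -- Here `≤-refl` is the proof of `n < suc n`.
  commonTail v₀ into = collide (pigeonhole ≤-refl (tail D ∘ f))
    where
    p : Fin n → Vertexᴸ
    p v = proj₁ (into v)

    head-p : ∀ v → head D (p v) ≡ v
    head-p v = let _ , _ , _ , h , _ = into v in h

    q₀ : Vertexᴸ
    q₀ = proj₁ (proj₂ (into v₀))

    q₀≢p : ∀ v → q₀ ≢ p v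
    q₀≢p v q₀≡p =
      -- Comparing heads forces `v` to be `v₀`, where the two chosen arcs differ.
      let _ , _ , p≢q , _ , head-q₀ = into v₀
          v₀≡v = trans (sym head-q₀) (trans (cong (head D) q₀≡p) (head-p v))
      in  p≢q (trans (cong p v₀≡v) (sym q₀≡p))

    f : Fin (suc n) → Vertexᴸ
    f zero    = q₀
    f (suc v) = p v

    f-injective : ∀ i j → i ≢ j → f i ≢ f j
    f-injective zero    zero    i≢j _  = i≢j refl
    f-injective zero    (suc v) _   eq = q₀≢p v eq
    f-injective (suc v) zero    _   eq = q₀≢p v (sym eq)
    f-injective (suc v) (suc w) i≢j eq =
      -- `head D` is a left inverse of `p`, so `p` is injective.
      i≢j (cong suc (trans (sym (head-p v)) (trans (cong (head D) eq) (head-p w))))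

    collide : (∃₂ λ i j → i < j × tail D (f i) ≡ tail D (f j)) →
              ∃₂ λ c d → c ≢ d × tail D c ≡ tail D d
    collide (i , j , i<j , eq) = f i , f j , f-injective i j (<⇒≢ i<j) , eq

proposition2p2 : ∀ {n : ℕ} (D : Digraph n) → StronglyConnected D →
    ∀ {δ⁻ : ℕ} → IsMinInDegree (LineDigraph D) δ⁻ → 2 ≤ δ⁻ →
    ¬ AdmitsIdentifyingCode (LineDigraph D) 3
proposition2p2 D connected ((i₀ , _) , δ⁻≤∣N⁻∣) 2≤δ⁻ =
  -- The arc `i₀` attaining the minimum guarantees that `D` has an arc, and its tail supplies the
  -- vertex at which a second incoming arc is taken.
  let out = outArc D connected i₀
      c , d , c≢d , tc≡td =
        commonTail D (tail D i₀) (inArcs D out λ i → ≤-trans 2≤δ⁻ (δ⁻≤∣N⁻∣ i))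
      a , ta≡hc = out (head D c)
      b , tb≡hd = out (head D d)
  in  twins⇒¬AdmitsIdentifyingCode-3 (LineDigraph D)
        (λ hx≡tc → trans hx≡tc tc≡td) (λ hx≡td → trans hx≡td (sym tc≡td))
        (sym ta≡hc) (sym tb≡hd)
        -- If `d` were `a`, it would leave the head of `c`; sharing its tail with `c`, it would make
        -- `c` a loop.
        (λ d≡a → tail≢head D c (trans tc≡td (trans (cong (tail D) d≡a) ta≡hc)))
        -- If `d` were `b`, it would leave its own head and be a loop.
        (λ d≡b → tail≢head D d (trans (cong (tail D) d≡b) tb≡hd))
        (c≢d ∘ sym)
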